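{- Let $a\ge 2$ be an integer, $p$ a prime and $n\ge 1$ an integer. Then $$N=\frac{a^{p^n}-1}{a^{p^{n-1}}-1}$$ is primover to base $a$ if and only if $\gcd\bigl(N,\,a^{p^{n-1}}-1\bigr)=1$.
   Context: For an integer $a>1$ and an odd integer $n>1$ with $\gcd(a,n)=1$: $h_a(n)$ denotes the multiplicative order of $a$ modulo $n$. A cyclotomic coset of $a$ modulo $n$ is a set of the form $\{\, s a^j \bmod n : j\ge 0\,\}$ with $s\in\{1,\dots,n-1\}$; these cosets partition $\{1,\dots,n-1\}$, and $r_a(n)$ denotes the number of distinct cyclotomic cosets of $a$ modulo $n$. An odd composite number $n$ coprime to $a$ is called an overpseudoprime to base $a$ if $n=r_a(n)\,h_a(n)+1$. An integer $N>1$ is called primover to base $a$ if it is either prime or an overpseudoprime to base $a$. -}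

module Defs where

open import Data.Fin using (Fin)
open import Data.Fin.Permutation using (↔⇒≡)
open import Data.Nat using (ℕ; zero; suc; _+_; _*_; _∸_; _^_; _≤_; _<_; NonZero; >-nonZero; s≤s; z≤n)
open import Data.Nat.Coprimality using (Coprime)
open import Data.Nat.Divisibility using (_∣_; _∣0; ∣-refl; ∣m∣n⇒∣m+n; ∣n⇒∣m*n)
open import Data.Nat.DivMod using (_%_)
open import Data.Nat.Primality using (Prime; Composite; prime⇒nonZero; composite⇒nonZero)
open import Data.Nat.Properties using (≤-antisym; ≤-trans; m<n⇒0<n∸m; ^-monoʳ-≤; ^-identityʳ; m^n>0; m^n≢0; ^-*-assoc; *-comm; +-∸-comm)
open import Data.Product using (_×_; _,_; ∃-syntax)
open import Data.Sum using (_⊎_)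
open import Function.Bundles using (Inverse)
import Function.Construct.Composition as Composition
import Function.Construct.Symmetry as Symmetry
open import Level using (0ℓ)
open import Relation.Binary.Bundles using (Setoid)
import Relation.Binary.Construct.On as On
open import Relation.Binary.PropositionalEquality using (_≡_; sym; trans; cong; subst; setoid)
open import Relation.Nullary using (¬_)
open import Relation.Unary using (Pred)
open import Relation.Unary.Relation.Binary.Equality using (≐-setoid)

-- h = h_a(n).
record IsOrder (a n h : ℕ) .{{_ : NonZero n}} : Set where
  field
    positive : 0 < h
    power≡1  : a ^ h % n ≡ 1 % n
    minimal  : ∀ k → 0 < k → a ^ k % n ≡ 1 % n → h ≤ k

Coset : (a n s : ℕ) .{{_ : NonZero n}} → Pred ℕ 0ℓ
Coset a n s x = ∃[ j ] x ≡ (s * a ^ j) % n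

-- A coset is given by a representative s ∈ {1,…,n-1}; two cosets are equal
-- when they are equal as sets, whatever the representatives.
CosetSetoid : (a n : ℕ) .{{_ : NonZero n}} → Setoid 0ℓ 0ℓ
CosetSetoid a n =
  On.setoid {B = ∃[ s ] (1 ≤ s × s < n)} (≐-setoid ℕ 0ℓ) (λ (s , _) → Coset a n s)

-- r = r_a(n): the set of distinct cosets has exactly r elements.
IsCosetCount : (a n r : ℕ) .{{_ : NonZero n}} → Set
IsCosetCount a n r = Inverse (CosetSetoid a n) (setoid (Fin r))

-- h_a(n) and r_a(n) are uniquely determined, so quantifying them
-- existentially below is the same as referring to their values.
IsOrder-unique : ∀ {a n h h′} .{{_ : NonZero n}} →
                 IsOrder a n h → IsOrder a n h′ → h ≡ h′
IsOrder-unique o o′ = ≤-antisym (O.minimal _ O′.positive O′.power≡1)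
                                (O′.minimal _ O.positive O.power≡1)
  where
  module O  = IsOrder o
  module O′ = IsOrder o′

IsCosetCount-unique : ∀ {a n r r′} .{{_ : NonZero n}} →
                      IsCosetCount a n r → IsCosetCount a n r′ → r ≡ r′
IsCosetCount-unique c c′ = ↔⇒≡ (Composition.inverse (Symmetry.inverse c) c′)

record Overpseudoprime (a n : ℕ) : Set where
  field
    odd       : ¬ 2 ∣ n
    composite : Composite n
    coprime   : Coprime n a
    n≡rh+1    : let instance _ = composite⇒nonZero composite in
                ∃[ r ] ∃[ h ] (IsCosetCount a n r × IsOrder a n h × n ≡ r * h + 1)

Primover : (a N : ℕ) → Set
Primover a N = 1 < N × (Prime N ⊎ Overpseudoprime a N)

a^p^m∸1≢0 : ∀ {a p} m → 2 ≤ a → Prime p → NonZero (a ^ (p ^ m) ∸ 1)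
a^p^m∸1≢0 {a} {p} m 2≤a pp = >-nonZero (m<n⇒0<n∸m (≤-trans 2≤a a≤a^p^m))
  where
  instance
    _ = prime⇒nonZero pp
    _ = >-nonZero (≤-trans (s≤s z≤n) 2≤a)
  a≤a^p^m : a ≤ a ^ (p ^ m)
  a≤a^p^m = subst (_≤ a ^ (p ^ m)) (^-identityʳ a) (^-monoʳ-≤ a (m^n>0 p m))

-- The division (a^(p^(m+1)) ∸ 1) / (a^(p^m) ∸ 1) is exact.
x∸1∣x^k∸1 : ∀ x .{{_ : NonZero x}} k → x ∸ 1 ∣ x ^ k ∸ 1
x∸1∣x^k∸1 x       zero    = (x ∸ 1) ∣0
x∸1∣x^k∸1 (suc y) (suc k) =
  subst (y ∣_) (sym (+-∸-comm (y * suc y ^ k) (m^n>0 (suc y) k)))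
    (∣m∣n⇒∣m+n (x∸1∣x^k∸1 (suc y) k) (subst (y ∣_) (*-comm (suc y ^ k) y) (∣n⇒∣m*n (suc y ^ k) ∣-refl)))

a^p^m∸1∣a^p^[1+m]∸1 : ∀ a .{{_ : NonZero a}} p m → a ^ (p ^ m) ∸ 1 ∣ a ^ (p ^ suc m) ∸ 1
a^p^m∸1∣a^p^[1+m]∸1 a p m = subst (λ y → a ^ (p ^ m) ∸ 1 ∣ y ∸ 1)
  (trans (^-*-assoc a (p ^ m) p) (cong (a ^_) (*-comm (p ^ m) p)))
  (x∸1∣x^k∸1 (a ^ (p ^ m)) {{m^n≢0 a (p ^ m)}} p)

{-# OPTIONS --safe #-}
module Submission where

-- Write q = p^(n-1), b = a^q, h = p^n, D = b - 1, so that N D = a^h - 1 and N > b.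
-- Every coset of a modulo N has at most h_a(N) elements, so N - 1 = r h_a(N) holds
-- iff no s in {1,…,N-1} satisfies s a^k ≡ s (mod N) with 0 < k < h_a(N).
-- If gcd(N, D) = 1, then s a^k ≡ s with 0 < k < h gives, by Bézout, s a^gcd(k,h) ≡ s;
-- since gcd(k, h) divides q, N divides s D and hence s, a contradiction.
-- If g = gcd(N, D) > 1, then s = N / g satisfies s a^q ≡ s, whereas q < h_a(N)
-- because 1 < a^k < N for 0 < k ≤ q.

open import Defs
open import Data.Fin as Fin using (Fin; toℕ; fromℕ<; combine; remQuot; punchOut)
open import Data.Fin.Properties as Fin using (toℕ<n; toℕ-fromℕ<; toℕ-injective; any?; injective⇒≤; punchOut-injective; remQuot-combine; combine-remQuot; combine-injectiveʳ)
open import Data.Nat using (ℕ; zero; suc; _+_; _*_; _∸_; _^_; _≤_; _<_; _≟_; NonZero; >-nonZero; >-nonZero⁻¹; nonTrivial⇒n>1; n>1⇒nonTrivial; s≤s; z≤n; s≤s⁻¹)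
open import Data.Nat.Coprimality using (Coprime; coprime-divisor; gcd≡1⇒coprime)
open import Data.Nat.DivMod using (_/_; _%_; %-distribˡ-*; %-remove-+ˡ; %-remove-+ʳ; m%n%n≡m%n; m%n<n; m<n⇒m%n≡m; m≡m%n+[m/n]*n; m/n*n≡m)
open import Data.Nat.Divisibility using (_∣_; divides; _∣0; ∣-refl; ∣-trans; ∣⇒≤; >⇒∤; ∣1⇒≡1; ∣m∣n⇒∣m+n; ∣m+n∣m⇒∣n; ∣m⇒∣m*n; m∣m*n; n∣m*n; *-monoʳ-∣; *-cancelʳ-∣)
open import Data.Nat.GCD using (gcd; gcd-GCD; gcd[m,n]∣m; gcd[m,n]∣n; gcd[m,n]≡0⇒m≡0; module Bézout)
open import Data.Nat.Primality using (Prime; Composite; prime?; prime⇒nonZero; prime⇒nonTrivial; prime⇒irreducible; ¬prime⇒composite; euclidsLemma)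
open import Data.Nat.Properties as ℕ using (+-comm; +-assoc; +-identityʳ; +-cancelˡ-≡; +-∸-assoc; *-assoc; *-comm; *-suc; *-identityˡ; *-identityʳ; *-cancelˡ-≡; *-monoˡ-≤; *-distribˡ-∸; ^-distribˡ-+-*; ^-identityʳ; ^-monoʳ-≤; m^n>0; m^n≢0; m∸n≤m; m∸n+n≡m; m+[n∸m]≡n; m<n⇒0<n∸m; ∸-monoˡ-≤; ∸-monoʳ-<; m≤m*n; m<m*n; n≢0⇒n>0; ≤-antisym; ≤-trans; ≤-reflexive; <-irrefl; <-trans; ≤-<-trans; <-cmp; <⇒≤; <⇒≢; <⇒≱; ≮⇒≥; ≰⇒>; ≤∧≢⇒<; module ≤-Reasoning)
open import Data.Product using (_×_; _,_; ∃-syntax; proj₁; proj₂; uncurry)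
open import Data.Sum using (_⊎_; inj₁; inj₂)
open import Function.Base using (_∘_)
open import Function.Bundles using (Inverse; _⇔_; mk⇔)
open import Function.Consequences.Propositional using (inverseʳ⇒injective; strictlyInverseʳ⇒inverseʳ)
open import Function.Definitions using (Injective)
open import Level using (0ℓ)
open import Relation.Binary.Bundles using (Setoid)
open import Relation.Binary.Definitions using (Decidable; tri<; tri≈; tri>)
open import Relation.Binary.PropositionalEquality using (_≡_; _≢_; refl; sym; trans; cong; subst; setoid; module ≡-Reasoning)
open import Relation.Nullary using (¬_; Dec; yes; no; contradiction)
open import Relation.Nullary.Decidable using (map′)
open import Relation.Unary using (_⊆_; _≐_)
open import Relation.Unary.Properties using (≐-refl)

-- Finite sets

-- Pigeonhole: if `y` were missed, punching it out of the codomain would inject `Fin (suc n)` into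
-- `Fin n`.
injective⇒strictlySurjective : ∀ {n} {f : Fin n → Fin n} → Injective _≡_ _≡_ f →
                               ∀ y → ∃[ x ] f x ≡ y
injective⇒strictlySurjective {suc n} {f} inj y with any? (λ x → f x Fin.≟ y)
... | yes hit  = hit
... | no  miss = contradiction (injective⇒≤ f′-injective) (<-irrefl refl)
  where
  y≢f : ∀ x → y ≢ f x
  y≢f x y≡fx = miss (x , sym y≡fx)
  f′-injective : Injective _≡_ _≡_ (λ x → punchOut (y≢f x))
  f′-injective {i} {j} eq = inj (punchOut-injective (y≢f i) (y≢f j) eq)

section-injective : ∀ {m n} (g : Fin m → Fin n) (σ : Fin n → Fin m) →
                    (∀ y → g (σ y) ≡ y) → Injective _≡_ _≡_ σ
section-injective g σ gσ = inverseʳ⇒injective {f⁻¹ = g} σ (strictlyInverseʳ⇒inverseʳ σ gσ)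

-- The section `σ` is injective, hence onto because the sizes agree. So every argument of `g` has
-- the form `σ u`, and `g` recovers `u` from it.
section⇒injective : ∀ {m n} → m ≡ n → (g : Fin m → Fin n) (σ : Fin n → Fin m) →
                    (∀ y → g (σ y) ≡ y) → Injective _≡_ _≡_ g
section⇒injective refl g σ gσ {x} {y} gx≡gy
  with u , refl ← injective⇒strictlySurjective (section-injective g σ gσ) x
     | v , refl ← injective⇒strictlySurjective (section-injective g σ gσ) y
  = cong σ (trans (sym (gσ u)) (trans gx≡gy (gσ v)))

module _ (S : Setoid 0ℓ 0ℓ) (_≈?_ : Decidable (Setoid._≈_ S)) where

  open Setoid S using (Carrier; _≈_) renaming (refl to ≈-refl; sym to ≈-sym; trans to ≈-trans)

  record Representatives {m} (e : Fin m → Carrier) : Set where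
    field
      {size}        : ℕ
      rep           : Fin size → Carrier
      class         : Fin m → Fin size
      rep-class     : ∀ i → rep (class i) ≈ e i
      rep-injective : ∀ k l → rep k ≈ rep l → k ≡ l

  -- Greedy choice: the head of the family becomes a new representative only when no representative
  -- of the tail is equivalent to it.
  representatives : ∀ {m} (e : Fin m → Carrier) → Representatives e
  representatives {zero} e = record
    { size = 0 ; rep = λ () ; class = λ () ; rep-class = λ () ; rep-injective = λ () }
  representatives {suc m} e = extend (any? λ k → rep k ≈? e Fin.zero)
    where
    open Representatives (representatives (e ∘ Fin.suc))

    extend : Dec (∃[ k ] rep k ≈ e Fin.zero) → Representatives e
    extend (yes (k , rep-k)) = record
      { rep           = rep
      ; class         = λ { Fin.zero → k ; (Fin.suc i) → class i }
      ; rep-class     = λ { Fin.zero → rep-k ; (Fin.suc i) → rep-class i }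
      ; rep-injective = rep-injective
      }
    extend (no new) = record
      { rep           = rep′
      ; class         = λ { Fin.zero → Fin.zero ; (Fin.suc i) → Fin.suc (class i) }
      ; rep-class     = λ { Fin.zero → ≈-refl ; (Fin.suc i) → rep-class i }
      ; rep-injective = rep′-injective
      }
      where
      rep′ : Fin (suc size) → Carrier
      rep′ Fin.zero    = e Fin.zero
      rep′ (Fin.suc k) = rep k
      rep′-injective : ∀ k l → rep′ k ≈ rep′ l → k ≡ l
      rep′-injective Fin.zero    Fin.zero    _  = refl
      rep′-injective Fin.zero    (Fin.suc l) eq = contradiction (l , ≈-sym eq) new
      rep′-injective (Fin.suc k) Fin.zero    eq = contradiction (k , eq) new
      rep′-injective (Fin.suc k) (Fin.suc l) eq = cong Fin.suc (rep-injective k l eq)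

  -- Through `ix` the family `e` meets every class of `S`, so its representatives form a transversal
  -- of the whole setoid.
  finite-quotient : ∀ {m} (e : Fin m → Carrier) (ix : Carrier → Fin m) →
                    (∀ x → e (ix x) ≈ x) → ∃[ r ] Inverse S (setoid (Fin r))
  finite-quotient e ix e-ix = size , record
    { to        = class ∘ ix
    ; from      = rep
    ; to-cong   = λ {x} {y} x≈y →
        rep-injective _ _ (≈-trans (rep-to x) (≈-trans x≈y (≈-sym (rep-to y))))
    ; from-cong = λ { refl → ≈-refl }
    ; inverse   = (λ {k} {x} x≈ → rep-injective _ k (≈-trans (rep-to x) x≈))
                , (λ {x} → λ { refl → rep-to x })
    }
    where
    open Representatives (representatives e)
    rep-to : ∀ x → rep (class (ix x)) ≈ x
    rep-to x = ≈-trans (rep-class (ix x)) (e-ix x)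

-- Multiplication by powers of a modulo n

module _ (n : ℕ) .{{_ : NonZero n}} where

  %-*-congˡ : ∀ x y z → x % n ≡ y % n → (x * z) % n ≡ (y * z) % n
  %-*-congˡ x y z x≡y = begin
    (x * z) % n             ≡⟨ %-distribˡ-* x z n ⟩
    ((x % n) * (z % n)) % n ≡⟨ cong (λ w → (w * (z % n)) % n) x≡y ⟩
    ((y % n) * (z % n)) % n ≡⟨ %-distribˡ-* y z n ⟨
    (y * z) % n             ∎
    where open ≡-Reasoning

  %-*-removeˡ : ∀ x z → (x % n * z) % n ≡ (x * z) % n
  %-*-removeˡ x z = %-*-congˡ (x % n) x z (m%n%n≡m%n x n)

module _ (a n : ℕ) .{{_ : NonZero n}} where

  -- Equivalent to a^k ≡ 1 modulo n / gcd(n, s); the cycle s, s a, s a², ... returns to s after k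
  -- steps.
  Fixes : ℕ → ℕ → Set
  Fixes s k = (s * a ^ k) % n ≡ s % n

  *-^-+ : ∀ s k i → s * a ^ (k + i) ≡ s * a ^ k * a ^ i
  *-^-+ s k i = trans (cong (s *_) (^-distribˡ-+-* a k i)) (sym (*-assoc s (a ^ k) (a ^ i)))

  Fixes-+ : ∀ s k i → Fixes s k → (s * a ^ (k + i)) % n ≡ (s * a ^ i) % n
  Fixes-+ s k i fix =
    trans (cong (_% n) (*-^-+ s k i)) (%-*-congˡ n (s * a ^ k) s (a ^ i) fix)

  Fixes-* : ∀ s k x → Fixes s k → Fixes s (x * k)
  Fixes-* s k zero    fix = cong (_% n) (*-identityʳ s)
  Fixes-* s k (suc x) fix = trans (Fixes-+ s k (x * k) fix) (Fixes-* s k x fix)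

  Fixes-∣ : ∀ s {k l} → k ∣ l → Fixes s k → Fixes s l
  Fixes-∣ s {k} (divides x refl) = Fixes-* s k x

  -- The hypothesis is d = x k - y l without negative exponents. No inverse of `a` is called for: s
  -- a^(y l) can be replaced by s inside s a^(y l + d) = s a^(x k).
  Fixes-cancel : ∀ s {k l d} x y → d + y * l ≡ x * k → Fixes s k → Fixes s l → Fixes s d
  Fixes-cancel s {k} {l} {d} x y eq fixₖ fixₗ = begin
    (s * a ^ d) % n           ≡⟨ Fixes-+ s (y * l) d (Fixes-* s l y fixₗ) ⟨
    (s * a ^ (y * l + d)) % n ≡⟨ cong (λ e → (s * a ^ e) % n) (trans (+-comm (y * l) d) eq) ⟩
    (s * a ^ (x * k)) % n     ≡⟨ Fixes-* s k x fixₖ ⟩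
    s % n                     ∎
    where open ≡-Reasoning

  -- Bézout writes the gcd as a difference of multiples of `k` and `l`; the two cases are the two
  -- possible signs.
  Fixes-gcd : ∀ s k l → Fixes s k → Fixes s l → Fixes s (gcd k l)
  Fixes-gcd s k l fixₖ fixₗ with Bézout.identity (gcd-GCD k l)
  ... | Bézout.+- x y eq = Fixes-cancel s x y eq fixₖ fixₗ
  ... | Bézout.-+ x y eq = Fixes-cancel s y x eq fixₗ fixₖ

  a^h≡1⇒Fixes : ∀ s h → a ^ h % n ≡ 1 % n → Fixes s h
  a^h≡1⇒Fixes s h a^h≡1 = begin
    (s * a ^ h) % n ≡⟨ cong (_% n) (*-comm s (a ^ h)) ⟩
    (a ^ h * s) % n ≡⟨ %-*-congˡ n (a ^ h) 1 s a^h≡1 ⟩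
    (1 * s) % n     ≡⟨ cong (_% n) (*-identityˡ s) ⟩
    s % n           ∎
    where open ≡-Reasoning

  Coset-refl : ∀ s → s < n → Coset a n s s
  Coset-refl s s<n = 0 , sym (trans (cong (_% n) (*-identityʳ s)) (m<n⇒m%n≡m s<n))

  Coset-trans : ∀ s {t} → Coset a n s t → Coset a n t ⊆ Coset a n s
  Coset-trans s (j , refl) (i , refl) =
    j + i , trans (%-*-removeˡ n (s * a ^ j) (a ^ i)) (cong (_% n) (sym (*-^-+ s j i)))

  Coset-Fixes : ∀ s {t} k → Coset a n s t → Fixes s k → Fixes t k
  Coset-Fixes s k (j , refl) fix = begin
    ((s * a ^ j) % n * a ^ k) % n ≡⟨ %-*-removeˡ n (s * a ^ j) (a ^ k) ⟩
    (s * a ^ j * a ^ k) % n       ≡⟨ cong (_% n) (*-^-+ s j k) ⟨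
    (s * a ^ (j + k)) % n         ≡⟨ cong (λ e → (s * a ^ e) % n) (+-comm j k) ⟩
    (s * a ^ (k + j)) % n         ≡⟨ Fixes-+ s k j fix ⟩
    (s * a ^ j) % n               ≡⟨ m%n%n≡m%n (s * a ^ j) n ⟨
    (s * a ^ j) % n % n           ∎
    where open ≡-Reasoning

-- Counting nonzero residues by cosets

-- With modulus `suc m`, `Fin m` indexes the nonzero residues. The exponent `h` is any positive one
-- with a^h ≡ 1; it is later instantiated both by the order and by p^(n+1).
module _ (a m h : ℕ) .{{_ : NonZero h}} (a^h≡1 : a ^ h % suc m ≡ 1 % suc m) where

  private n = suc m

  open Setoid (CosetSetoid a n) using (_≈_) renaming (Carrier to Residue)

  Fixes-h : ∀ s x → Fixes a n s (x * h)
  Fixes-h s x = Fixes-* a n s h x (a^h≡1⇒Fixes a n s h a^h≡1)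

  -- Here a^(h-1) is an inverse of `a`, so a^(j (h-1)) undoes a^j: the exponents add up to j h.
  Coset-sym : ∀ s {t} → s < n → Coset a n s t → Coset a n t s
  Coset-sym s s<n (j , refl) = j * (h ∸ 1) , sym (begin
    ((s * a ^ j) % n * a ^ (j * (h ∸ 1))) % n ≡⟨ %-*-removeˡ n (s * a ^ j) (a ^ (j * (h ∸ 1))) ⟩
    (s * a ^ j * a ^ (j * (h ∸ 1))) % n       ≡⟨ cong (_% n) (*-^-+ a n s j (j * (h ∸ 1))) ⟨
    (s * a ^ (j + j * (h ∸ 1))) % n           ≡⟨ cong (λ e → (s * a ^ e) % n) exponent ⟩
    (s * a ^ (j * h)) % n                     ≡⟨ Fixes-h s j ⟩
    s % n                                     ≡⟨ m<n⇒m%n≡m s<n ⟩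
    s                                         ∎)
    where
    open ≡-Reasoning
    exponent : j + j * (h ∸ 1) ≡ j * h
    exponent = trans (sym (*-suc j (h ∸ 1)))
      (cong (j *_) (trans (+-comm 1 (h ∸ 1)) (m∸n+n≡m (>-nonZero⁻¹ h))))

  -- If 0 lay in the coset of `s`, symmetry would place `s` in the coset of 0, which is {0}.
  Coset-positive : ∀ s {t} → 1 ≤ s → s < n → Coset a n s t → 1 ≤ t
  Coset-positive s {suc t} _ _ _ = s≤s z≤n
  Coset-positive s {zero} 1≤s s<n t∈s with Coset-sym s s<n t∈s
  ... | _ , refl = contradiction 1≤s λ ()

  Coset-≐ : ∀ s t → s < n → Coset a n s t → Coset a n s ≐ Coset a n t
  Coset-≐ s t s<n t∈s = Coset-trans a n t (Coset-sym s s<n t∈s) , Coset-trans a n s t∈s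

  -- Exponents matter only modulo `h`. This bounds the search that decides membership and lets
  -- `Fin h` run through a coset.
  Coset-reduce : ∀ s {t} → Coset a n s t → ∃[ j ] t ≡ (s * a ^ toℕ {h} j) % n
  Coset-reduce s (j , refl) = fromℕ< (m%n<n j h) , (begin
    (s * a ^ j) % n                        ≡⟨ cong (λ e → (s * a ^ e) % n) (m≡m%n+[m/n]*n j h) ⟩
    (s * a ^ (j % h + j / h * h)) % n      ≡⟨ cong (λ e → (s * a ^ e) % n) (+-comm (j % h) (j / h * h)) ⟩
    (s * a ^ (j / h * h + j % h)) % n      ≡⟨ Fixes-+ a n s (j / h * h) (j % h) (Fixes-h s (j / h)) ⟩
    (s * a ^ (j % h)) % n                  ≡⟨ cong (λ e → (s * a ^ e) % n) (toℕ-fromℕ< (m%n<n j h)) ⟨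
    (s * a ^ toℕ (fromℕ< (m%n<n j h))) % n ∎)
    where open ≡-Reasoning

  Coset? : ∀ s t → Dec (Coset a n s t)
  Coset? s t = map′ (λ (j , eq) → toℕ j , eq) (Coset-reduce s) (any? λ j → t ≟ (s * a ^ toℕ {h} j) % n)

  residue : Fin m → Residue
  residue i = suc (toℕ i) , s≤s z≤n , s≤s (toℕ<n i)

  index : Residue → Fin m
  index (suc s , _ , s<n) = fromℕ< (s≤s⁻¹ s<n)

  residue-index : ∀ x → proj₁ (residue (index x)) ≡ proj₁ x
  residue-index (suc s , _ , s<n) = cong suc (toℕ-fromℕ< (s≤s⁻¹ s<n))

  index-residue : ∀ x i → proj₁ x ≡ proj₁ (residue i) → index x ≡ i
  index-residue (suc s , _ , s<n) i refl = toℕ-injective (toℕ-fromℕ< (s≤s⁻¹ s<n))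

  index-injective : ∀ x y → index x ≡ index y → proj₁ x ≡ proj₁ y
  index-injective x y eq =
    trans (sym (residue-index x)) (trans (cong (proj₁ ∘ residue) eq) (residue-index y))

  cosetCount : ∃[ r ] IsCosetCount a n r
  cosetCount = finite-quotient (CosetSetoid a n) _≈?_ residue index
    λ x → subst (λ s → Coset a n s ≐ Coset a n (proj₁ x)) (sym (residue-index x)) ≐-refl
    where
    _≈?_ : Decidable _≈_
    (s , _ , s<n) ≈? (t , _ , t<n) =
      map′ (Coset-≐ s t s<n) (λ s≈t → proj₂ s≈t (Coset-refl a n t t<n)) (Coset? s t)

  -- The cyclic group of order `h` acts on the residues through the powers of `a`; this is freeness
  -- of its action on the nonzero ones, that is, every coset has exactly `h` elements.
  Free : Set
  Free = ∀ s k → 1 ≤ s → s < n → 0 < k → k < h → ¬ Fixes a n s k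

  -- Minimality is freeness at s = 1, a nonzero residue because 1 < n.
  free⇒IsOrder : 1 < n → Free → IsOrder a n h
  free⇒IsOrder 1<n free = record
    { positive = >-nonZero⁻¹ h
    ; power≡1  = a^h≡1
    ; minimal  = λ k 0<k a^k≡1 → ≮⇒≥ λ k<h → free 1 k (s≤s z≤n) 1<n 0<k k<h (a^h≡1⇒Fixes a n 1 k a^k≡1)
    }

  -- Undo the power a ^ i by the remaining a ^ (h ∸ i).
  collision⇒Fixes : ∀ s i j → i < j → j < h → (s * a ^ i) % n ≡ (s * a ^ j) % n → Fixes a n s (j ∸ i)
  collision⇒Fixes s i j i<j j<h eq = begin
    (s * a ^ (j ∸ i)) % n           ≡⟨ Fixes-+ a n s h (j ∸ i) fixₕ ⟨
    (s * a ^ (h + (j ∸ i))) % n     ≡⟨ cong (λ e → (s * a ^ e) % n) exponent ⟩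
    (s * a ^ (j + (h ∸ i))) % n     ≡⟨ cong (_% n) (*-^-+ a n s j (h ∸ i)) ⟩
    (s * a ^ j * a ^ (h ∸ i)) % n   ≡⟨ %-*-congˡ n (s * a ^ i) (s * a ^ j) (a ^ (h ∸ i)) eq ⟨
    (s * a ^ i * a ^ (h ∸ i)) % n   ≡⟨ cong (_% n) (*-^-+ a n s i (h ∸ i)) ⟨
    (s * a ^ (i + (h ∸ i))) % n     ≡⟨ cong (λ e → (s * a ^ e) % n) (m+[n∸m]≡n i≤h) ⟩
    (s * a ^ h) % n                 ≡⟨ fixₕ ⟩
    s % n                           ∎
    where
    open ≡-Reasoning
    fixₕ = a^h≡1⇒Fixes a n s h a^h≡1
    i≤h = <⇒≤ (<-trans i<j j<h)
    exponent : h + (j ∸ i) ≡ j + (h ∸ i)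
    exponent = begin
      h + (j ∸ i) ≡⟨ +-∸-assoc h (<⇒≤ i<j) ⟨
      h + j ∸ i   ≡⟨ cong (_∸ i) (+-comm h j) ⟩
      j + h ∸ i   ≡⟨ +-∸-assoc j i≤h ⟩
      j + (h ∸ i) ∎

  free⇒exponents-≡ : Free → ∀ s (i j : Fin h) → 1 ≤ s → s < n →
                     (s * a ^ toℕ i) % n ≡ (s * a ^ toℕ j) % n → i ≡ j
  free⇒exponents-≡ free s i j 1≤s s<n eq with <-cmp (toℕ i) (toℕ j)
  ... | tri≈ _ i≡j _ = toℕ-injective i≡j
  ... | tri< i<j _ _ = contradiction (collision⇒Fixes s (toℕ i) (toℕ j) i<j (toℕ<n j) eq)
    (free s (toℕ j ∸ toℕ i) 1≤s s<n (m<n⇒0<n∸m i<j) (≤-<-trans (m∸n≤m (toℕ j) (toℕ i)) (toℕ<n j)))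
  ... | tri> _ _ j<i = contradiction (collision⇒Fixes s (toℕ j) (toℕ i) j<i (toℕ<n i) (sym eq))
    (free s (toℕ i ∸ toℕ j) 1≤s s<n (m<n⇒0<n∸m j<i) (≤-<-trans (m∸n≤m (toℕ i) (toℕ j)) (toℕ<n i)))

  module _ {r} (count : IsCosetCount a n r) where

    open Inverse count using (to; from; to-cong; strictlyInverseˡ; strictlyInverseʳ)

    rep : Fin r → ℕ
    rep i = proj₁ (from i)

    rep≥1 : ∀ i → 1 ≤ rep i
    rep≥1 i = proj₁ (proj₂ (from i))

    rep<n : ∀ i → rep i < n
    rep<n i = proj₂ (proj₂ (from i))

    ∈Coset-rep : ∀ x → Coset a n (rep (to x)) (proj₁ x)
    ∈Coset-rep x@(s , _ , s<n) = proj₂ (strictlyInverseʳ x) (Coset-refl a n s s<n)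

    rep-injective : ∀ i j → Coset a n (rep i) (rep j) → i ≡ j
    rep-injective i j j∈i = trans (sym (strictlyInverseˡ i))
      (trans (to-cong {from i} {from j} (Coset-≐ (rep i) (rep j) (rep<n i) j∈i)) (strictlyInverseˡ j))

    element : Fin r × Fin h → Residue
    element (i , j) = (rep i * a ^ toℕ j) % n
                    , Coset-positive (rep i) (rep≥1 i) (rep<n i) (toℕ j , refl)
                    , m%n<n (rep i * a ^ toℕ j) n

    -- Pairs of a coset and an exponent cover all nonzero residues, with `locate` as a section.
    -- Hence m ≤ r h, and equality amounts to injectivity of this map.
    enumerate : Fin (r * h) → Fin m
    enumerate = index ∘ element ∘ remQuot h

    exponent : ∀ x → ∃[ j ] proj₁ x ≡ (rep (to x) * a ^ toℕ {h} j) % n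
    exponent x = Coset-reduce (rep (to x)) (∈Coset-rep x)

    locate : Fin m → Fin (r * h)
    locate y = combine (to x) (proj₁ (exponent x))
      where x = residue y

    enumerate-locate : ∀ y → enumerate (locate y) ≡ y
    enumerate-locate y = index-residue (element (remQuot h (locate y))) y (trans
      (cong (proj₁ ∘ element) (remQuot-combine (to x) (proj₁ (exponent x))))
      (sym (proj₂ (exponent x))))
      where x = residue y

    -- Equal sizes make `enumerate` injective. If `k` fixes `s`, it also fixes the representative of
    -- its coset, so the exponents 0 and `k` give the same residue there.
    count⇒free : m ≡ r * h → Free
    count⇒free m≡rh s k 1≤s s<n 0<k k<h fix = <-irrefl 0≡k 0<k
      where
      i = to (s , 1≤s , s<n)
      j₀ j₁ : Fin h
      j₀ = fromℕ< (<-trans 0<k k<h)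
      j₁ = fromℕ< k<h

      rep-fixed : Fixes a n (rep i) k
      rep-fixed = Coset-Fixes a n s k (Coset-sym (rep i) (rep<n i) (∈Coset-rep (s , 1≤s , s<n))) fix

      collide : proj₁ (element (i , j₀)) ≡ proj₁ (element (i , j₁))
      collide = begin
        (rep i * a ^ toℕ j₀) % n ≡⟨ cong (λ e → (rep i * a ^ e) % n) (toℕ-fromℕ< (<-trans 0<k k<h)) ⟩
        (rep i * 1) % n          ≡⟨ cong (_% n) (*-identityʳ (rep i)) ⟩
        rep i % n                ≡⟨ rep-fixed ⟨
        (rep i * a ^ k) % n      ≡⟨ cong (λ e → (rep i * a ^ e) % n) (toℕ-fromℕ< k<h) ⟨
        (rep i * a ^ toℕ j₁) % n ∎
        where open ≡-Reasoning

      enumerate-combine : ∀ j → proj₁ (residue (enumerate (combine i j))) ≡ proj₁ (element (i , j))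
      enumerate-combine j = trans (residue-index (element (remQuot h (combine i j))))
        (cong (proj₁ ∘ element) (remQuot-combine i j))

      same : enumerate (combine i j₀) ≡ enumerate (combine i j₁)
      same = index-residue (element (remQuot h (combine i j₀))) (enumerate (combine i j₁))
        (trans (cong (proj₁ ∘ element) (remQuot-combine i j₀)) (trans collide (sym (enumerate-combine j₁))))

      0≡k : 0 ≡ k
      0≡k = begin
        0      ≡⟨ toℕ-fromℕ< (<-trans 0<k k<h) ⟨
        toℕ j₀ ≡⟨ cong toℕ (combine-injectiveʳ i j₀ i j₁
                    (section⇒injective (sym m≡rh) enumerate locate enumerate-locate same)) ⟩
        toℕ j₁ ≡⟨ toℕ-fromℕ< k<h ⟩
        k      ∎
        where open ≡-Reasoning

    -- `locate` injects `Fin m` into `Fin (r * h)`; freeness makes `enumerate` an injection the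
    -- other way.
    free⇒count : Free → m ≡ r * h
    free⇒count free = ≤-antisym
      (injective⇒≤ (section-injective enumerate locate enumerate-locate))
      (injective⇒≤ enumerate-injective)
      where
      element-injective : ∀ x y → proj₁ (element x) ≡ proj₁ (element y) → x ≡ y
      element-injective (i , j) (i′ , j′) eq
        -- The common element links the two representatives, so the cosets coincide; freeness then
        -- separates the exponents.
        with refl ← rep-injective i i′ (Coset-trans a n (rep i) (toℕ j , sym eq)
                      (Coset-sym (rep i′) (rep<n i′) (toℕ j′ , refl)))
        = cong (i ,_) (free⇒exponents-≡ free (rep i) j j′ (rep≥1 i) (rep<n i) eq)

      enumerate-injective : Injective _≡_ _≡_ enumerate
      enumerate-injective {x} {y} eq = begin
        x                                 ≡⟨ combine-remQuot {r} h x ⟨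
        uncurry combine (remQuot {r} h x) ≡⟨ cong (uncurry combine) (element-injective _ _ elements-≡) ⟩
        uncurry combine (remQuot {r} h y) ≡⟨ combine-remQuot {r} h y ⟩
        y                                 ∎
        where
        open ≡-Reasoning
        elements-≡ = index-injective (element (remQuot h x)) (element (remQuot h y)) eq

-- Divisibility

%-+-cancel : ∀ x y n .{{_ : NonZero n}} → (x + y) % n ≡ x % n → n ∣ y
%-+-cancel x y n eq = ∣m+n∣m⇒∣n (divides ((x + y) / n) (+-cancelˡ-≡ (x % n) _ _ (begin
  x % n + (x / n * n + y)         ≡⟨ +-assoc (x % n) (x / n * n) y ⟨
  x % n + x / n * n + y           ≡⟨ cong (_+ y) (m≡m%n+[m/n]*n x n) ⟨
  x + y                           ≡⟨ m≡m%n+[m/n]*n (x + y) n ⟩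
  (x + y) % n + (x + y) / n * n   ≡⟨ cong (_+ (x + y) / n * n) eq ⟩
  x % n + (x + y) / n * n         ∎))) (n∣m*n (x / n))
  where open ≡-Reasoning

module _ (a n : ℕ) .{{_ : NonZero a}} .{{_ : NonZero n}} where

  private
    *-^-split : ∀ s k → s * a ^ k ≡ s + s * (a ^ k ∸ 1)
    *-^-split s k = trans (cong (s *_) (sym (m+[n∸m]≡n (m^n>0 a k)))) (*-suc s (a ^ k ∸ 1))

  Fixes⇒∣ : ∀ s k → Fixes a n s k → n ∣ s * (a ^ k ∸ 1)
  Fixes⇒∣ s k fix = %-+-cancel s (s * (a ^ k ∸ 1)) n (trans (cong (_% n) (sym (*-^-split s k))) fix)

  ∣⇒Fixes : ∀ s k → n ∣ s * (a ^ k ∸ 1) → Fixes a n s k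
  ∣⇒Fixes s k n∣ = trans (cong (_% n) (*-^-split s k)) (%-remove-+ʳ s n∣)

-- In p · p^n = e d, Euclid's lemma puts `p` into `e` or `d`. In the first case `p` cancels and `d`
-- divides p^n; in the second d = d′ p with d′ dividing p^n, and induction on `n` applies to d′.
∣p^[1+n]⇒≡⊎∣p^n : ∀ {p} → Prime p → ∀ n {d} → d ∣ p ^ suc n → d ≡ p ^ suc n ⊎ d ∣ p ^ n
∣p^[1+n]⇒≡⊎∣p^n {p} pp n {d} (divides e eq)
  with euclidsLemma e d pp (subst (p ∣_) eq (m∣m*n (p ^ n)))
... | inj₁ (divides e′ refl) = inj₂ (divides e′ (*-cancelˡ-≡ _ _ p {{prime⇒nonZero pp}} (begin
  p * p ^ n      ≡⟨ eq ⟩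
  e′ * p * d     ≡⟨ cong (_* d) (*-comm e′ p) ⟩
  p * e′ * d     ≡⟨ *-assoc p e′ d ⟩
  p * (e′ * d)   ∎)))
  where open ≡-Reasoning
... | inj₂ (divides d′ refl) = cofactor n (*-cancelʳ-∣ p {{prime⇒nonZero pp}}
        (divides e (trans (*-comm (p ^ n) p) eq)))
  where
  cofactor : ∀ n → d′ ∣ p ^ n → d′ * p ≡ p ^ suc n ⊎ d′ * p ∣ p ^ n
  cofactor zero    d′∣1 = inj₁ (trans (cong (_* p) (∣1⇒≡1 d′∣1)) (*-comm 1 p))
  cofactor (suc n) d′∣  with ∣p^[1+n]⇒≡⊎∣p^n pp n d′∣
  ... | inj₁ refl   = inj₁ (*-comm (p ^ suc n) p)
  ... | inj₂ d′∣p^n = inj₂ (subst (_∣ p ^ suc n) (*-comm p d′) (*-monoʳ-∣ p d′∣p^n))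

-- The gcd is at most k < p^(n+1), hence a proper divisor of p^(n+1).
gcd[k,p^[1+n]]∣p^n : ∀ {p} → Prime p → ∀ n {k} → 0 < k → k < p ^ suc n → gcd k (p ^ suc n) ∣ p ^ n
gcd[k,p^[1+n]]∣p^n {p} pp n {k} 0<k k<p^[1+n]
  with ∣p^[1+n]⇒≡⊎∣p^n pp n (gcd[m,n]∣n k (p ^ suc n))
... | inj₂ g∣p^n = g∣p^n
... | inj₁ g≡    = contradiction
  (≤-trans (≤-reflexive (sym g≡)) (∣⇒≤ {{>-nonZero 0<k}} (gcd[m,n]∣m k (p ^ suc n)))) (<⇒≱ k<p^[1+n])

2∣n⊎2∣1+n : ∀ n → 2 ∣ n ⊎ 2 ∣ suc n
2∣n⊎2∣1+n zero    = inj₁ (2 ∣0)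
2∣n⊎2∣1+n (suc n) with 2∣n⊎2∣1+n n
... | inj₁ 2∣n   = inj₂ (∣m∣n⇒∣m+n ∣-refl 2∣n)
... | inj₂ 2∣1+n = inj₁ 2∣1+n

-- The quotient N, with `n` now standing for the exponent n - 1 of the theorem

module _ {a p : ℕ} (n : ℕ) (2≤a : 2 ≤ a) (pp : Prime p) where

  private
    q = p ^ n
    h = p ^ suc n
    b = a ^ q
    D = b ∸ 1

    instance
      a≢0 : NonZero a
      a≢0 = >-nonZero (<⇒≤ 2≤a)
      p≢0 : NonZero p
      p≢0 = prime⇒nonZero pp
      q≢0 : NonZero q
      q≢0 = m^n≢0 p n
      h≢0 : NonZero h
      h≢0 = m^n≢0 p (suc n)
      D≢0 : NonZero D
      D≢0 = a^p^m∸1≢0 n 2≤a pp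

  a^k≥2 : ∀ k → 0 < k → 2 ≤ a ^ k
  a^k≥2 k 0<k = ≤-trans 2≤a (subst (_≤ a ^ k) (^-identityʳ a) (^-monoʳ-≤ a 0<k))

  module _ {m : ℕ} (ND≡a^h∸1 : suc m * D ≡ a ^ h ∸ 1) where

    private N = suc m

    -- Otherwise N D ≤ b (b - 1) = b² - b < b² - 1 ≤ a^h - 1, where the last step uses h = p q ≥ 2
    -- q.
    b<N : b < N
    b<N = ≰⇒> λ N≤b → <-irrefl ND≡a^h∸1 (begin-strict
      N * D         ≤⟨ *-monoˡ-≤ D N≤b ⟩
      b * D         ≡⟨ *-distribˡ-∸ b b 1 ⟩
      b * b ∸ b * 1 ≡⟨ cong (b * b ∸_) (*-identityʳ b) ⟩
      b * b ∸ b     <⟨ ∸-monoʳ-< (a^k≥2 q (>-nonZero⁻¹ q)) (m≤m*n b b {{m^n≢0 a q}}) ⟩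
      b * b ∸ 1     ≤⟨ ∸-monoˡ-≤ 1 b*b≤a^h ⟩
      a ^ h ∸ 1     ∎)
      where
      open ≤-Reasoning
      b*b≤a^h : b * b ≤ a ^ h
      b*b≤a^h = begin
        b * b       ≡⟨ ^-distribˡ-+-* a q q ⟨
        a ^ (q + q) ≡⟨ cong (λ e → a ^ (q + e)) (+-identityʳ q) ⟨
        a ^ (2 * q) ≤⟨ ^-monoʳ-≤ a (*-monoˡ-≤ q (nonTrivial⇒n>1 p {{prime⇒nonTrivial pp}})) ⟩
        a ^ h       ∎

    1<N : 1 < N
    1<N = <-trans (a^k≥2 q (>-nonZero⁻¹ q)) b<N

    N*D+1≡a^h : N * D + 1 ≡ a ^ h
    N*D+1≡a^h = trans (cong (_+ 1) ND≡a^h∸1) (m∸n+n≡m (m^n>0 a h))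

    a^h≡1 : a ^ h % N ≡ 1 % N
    a^h≡1 = trans (cong (_% N) (sym N*D+1≡a^h)) (%-remove-+ˡ 1 (m∣m*n D))

    -- A prime N with a nontrivial common factor would divide D, but 0 < D < N.
    prime⇒gcd≡1 : Prime N → gcd N D ≡ 1
    prime⇒gcd≡1 pN with prime⇒irreducible pN (gcd[m,n]∣m N D)
    ... | inj₁ g≡1 = g≡1
    ... | inj₂ g≡N = contradiction (subst (_∣ D) g≡N (gcd[m,n]∣n N D)) (>⇒∤ (≤-<-trans (m∸n≤m b 1) b<N))

    q<order : ∀ {k} → IsOrder a N k → q < k
    q<order {k} o = ≰⇒> λ k≤q → <-irrefl (sym (begin
      a ^ k     ≡⟨ m<n⇒m%n≡m (≤-<-trans (^-monoʳ-≤ a k≤q) b<N) ⟨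
      a ^ k % N ≡⟨ power≡1 ⟩
      1 % N     ≡⟨ m<n⇒m%n≡m 1<N ⟩
      1         ∎)) (a^k≥2 k positive)
      where
      open IsOrder o
      open ≡-Reasoning

    -- If g = gcd N D > 1, then N / g is fixed by multiplication by a ^ q, so its coset is too short.
    overpseudoprime⇒gcd≡1 : Overpseudoprime a N → gcd N D ≡ 1
    overpseudoprime⇒gcd≡1 ops with gcd N D ≟ 1
    ... | yes g≡1 = g≡1
    ... | no  g≢1 = contradiction fixed (free s q s≥1 s<N (>-nonZero⁻¹ q) (q<order order))
      where
      open Overpseudoprime ops
      g = gcd N D
      r = proj₁ n≡rh+1
      k = proj₁ (proj₂ n≡rh+1)
      count = proj₁ (proj₂ (proj₂ n≡rh+1))
      order : IsOrder a N k
      order = proj₁ (proj₂ (proj₂ (proj₂ n≡rh+1)))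
      N≡rk+1 : N ≡ r * k + 1
      N≡rk+1 = proj₂ (proj₂ (proj₂ (proj₂ n≡rh+1)))
      instance
        k≢0 : NonZero k
        k≢0 = >-nonZero (IsOrder.positive order)
      free : Free a m k (IsOrder.power≡1 order)
      free = count⇒free a m k (IsOrder.power≡1 order) count
        (ℕ.suc-injective (trans N≡rk+1 (+-comm (r * k) 1)))

      open _∣_ (gcd[m,n]∣m N D) renaming (quotient to s; equality to N≡s*g)
      s≥1 : 1 ≤ s
      s≥1 = n≢0⇒n>0 λ s≡0 → contradiction (trans N≡s*g (cong (_* g) s≡0)) λ ()
      1<g : 1 < g
      1<g = ≤∧≢⇒< (n≢0⇒n>0 λ g≡0 → contradiction (gcd[m,n]≡0⇒m≡0 {N} {D} g≡0) λ ()) (g≢1 ∘ sym)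
      s<N : s < N
      s<N = subst (s <_) (sym N≡s*g) (m<m*n s g {{>-nonZero s≥1}} 1<g)
      -- N = s g divides s D because g divides D.
      fixed : Fixes a N s q
      fixed = ∣⇒Fixes a N s q (subst (_∣ s * D) (sym N≡s*g) (*-monoʳ-∣ s (gcd[m,n]∣n N D)))

    module _ (g≡1 : gcd N D ≡ 1) where

      -- s is also fixed by gcd k h, a divisor of q; hence N divides s * D.
      gcd≡1⇒free : Free a m h a^h≡1
      gcd≡1⇒free s k 1≤s s<N 0<k k<h fix = contradiction
        (coprime-divisor {n = D} (gcd≡1⇒coprime g≡1) (subst (N ∣_) (*-comm s D) (Fixes⇒∣ a N s q fix-q)))
        (>⇒∤ {{>-nonZero 1≤s}} s<N)
        where
        fix-q : Fixes a N s q
        fix-q = Fixes-∣ a N s (gcd[k,p^[1+n]]∣p^n pp n 0<k k<h)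
          (Fixes-gcd a N s k h fix (a^h≡1⇒Fixes a N s h a^h≡1))

      -- A common divisor of N and `a` divides both N D and a^h = N D + 1.
      N⊥a : Coprime N a
      N⊥a {d} (d∣N , d∣a) = ∣1⇒≡1 (∣m+n∣m⇒∣n (subst (d ∣_) (sym N*D+1≡a^h) d∣a^h) (∣m⇒∣m*n D d∣N))
        where
        d∣a^h : d ∣ a ^ h
        d∣a^h = subst (λ e → d ∣ a ^ e) (m+[n∸m]≡n (>-nonZero⁻¹ h)) (∣m⇒∣m*n (a ^ (h ∸ 1)) d∣a)

      -- One of a - 1 and a is even. As a - 1 divides D, an even N would share the factor 2 with D
      -- or with `a`.
      N-odd : ¬ 2 ∣ N
      N-odd 2∣N with 2∣n⊎2∣1+n (a ∸ 1)
      ... | inj₁ 2∣a∸1 = contradiction (gcd≡1⇒coprime g≡1 (2∣N , ∣-trans 2∣a∸1 (x∸1∣x^k∸1 a q))) λ ()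
      ... | inj₂ 2∣a   = contradiction (N⊥a (2∣N , subst (2 ∣_) (m+[n∸m]≡n (<⇒≤ 2≤a)) 2∣a)) λ ()

      composite⇒overpseudoprime : Composite N → Overpseudoprime a N
      composite⇒overpseudoprime cN = record
        { odd       = N-odd
        ; composite = cN
        ; coprime   = N⊥a
        -- Freeness serves twice: it identifies the order as h = p^(n+1), and it gives N - 1 = r h.
        ; n≡rh+1    = r , h , count , free⇒IsOrder a m h a^h≡1 1<N gcd≡1⇒free
                    , trans (cong suc (free⇒count a m h a^h≡1 count gcd≡1⇒free)) (+-comm 1 (r * h))
        }
        where
        r = proj₁ (cosetCount a m h a^h≡1)
        count = proj₂ (cosetCount a m h a^h≡1)

      gcd≡1⇒primover : Primover a N
      gcd≡1⇒primover with prime? N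
      ... | yes pN = 1<N , inj₁ pN
      ... | no ¬pN = 1<N , inj₂ (composite⇒overpseudoprime (¬prime⇒composite {{n>1⇒nonTrivial 1<N}} ¬pN))

  -- Describing N by an equation instead of a division allows matching on N as `suc m`; the value 0
  -- is excluded because a^h - 1 > 0.
  primover⇔gcd≡1 : ∀ N → N * D ≡ a ^ h ∸ 1 → Primover a N ⇔ gcd N D ≡ 1
  primover⇔gcd≡1 zero    0≡a^h∸1 =
    contradiction 0≡a^h∸1 (<⇒≢ (m<n⇒0<n∸m (a^k≥2 h (>-nonZero⁻¹ h))))
  primover⇔gcd≡1 (suc m) ND≡ = mk⇔
    (λ { (_ , inj₁ pN) → prime⇒gcd≡1 ND≡ pN ; (_ , inj₂ ops) → overpseudoprime⇒gcd≡1 ND≡ ops })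
    (gcd≡1⇒primover ND≡)

theorem7 : (a p n : ℕ) (2≤a : 2 ≤ a) (pp : Prime p) → 1 ≤ n →
    let D = a ^ (p ^ (n ∸ 1)) ∸ 1
        N = _/_ (a ^ (p ^ n) ∸ 1) D {{a^p^m∸1≢0 (n ∸ 1) 2≤a pp}}
    in Primover a N ⇔ gcd N D ≡ 1
theorem7 a p (suc n) 2≤a pp _ = primover⇔gcd≡1 n 2≤a pp _
  -- Exactness of the division yields N D = a^h - 1.
  (m/n*n≡m {{a^p^m∸1≢0 n 2≤a pp}} (a^p^m∸1∣a^p^[1+m]∸1 a {{>-nonZero (<⇒≤ 2≤a)}} p n))
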